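{- Let $a,b,c,d,e\in\mathbb{N}$ be such that $a\mid d$, $b\mid d$, $c\mid d$ and $\gcd(a,b,c)=1$. Let $F$ be the set of fundamental solutions of the diophantine equation $$ax^2+by^2+cz^2=dxyz+e.$$ If $F\neq\emptyset$, then $1\le e\le 4$.
   Context: $\mathbb{N}$ denotes the positive integers. A fundamental solution of $ax^2+by^2+cz^2=dxyz+e$ is a solution $(x,y,z)\in\mathbb{N}^3$ of this equation satisfying $$1\le x\le \frac{d}{2a}yz,\qquad 1\le y\le\frac{d}{2b}xz,\qquad 1\le z\le\frac{d}{2c}xy.$$ -}

module Defs where

open import Data.Nat using (ℕ; NonZero; _+_; _*_; _^_; _≤_)
open import Data.Nat.Properties using (m*n≢0)
open import Data.Integer using (+_)
open import Data.Product using (_×_; _,_)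
open import Data.Rational as ℚ using (ℚ)
open import Level using (0ℓ)
open import Relation.Binary.PropositionalEquality using (_≡_)
open import Relation.Unary using (Pred)

ι : ℕ → ℚ
ι n = + n ℚ./ 1

-- The rational number d/(2a), not the truncated quotient.
d/2a : (d a : ℕ) .{{_ : NonZero a}} → ℚ
d/2a d a = ℚ._/_ (+ d) (2 * a) {{m*n≢0 2 a}}

-- Solutions range over the positive integers: the lower bounds 1≤x, 1≤y, 1≤z
-- also carry the requirement that the coordinates be positive.
record IsFundamental (a b c d e : ℕ)
  .{{_ : NonZero a}} .{{_ : NonZero b}} .{{_ : NonZero c}}
  (x y z : ℕ) : Set where
  field
    solves : a * x ^ 2 + b * y ^ 2 + c * z ^ 2 ≡ d * x * y * z + e
    1≤x    : 1 ≤ x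
    1≤y    : 1 ≤ y
    1≤z    : 1 ≤ z
    x≤     : ι x ℚ.≤ d/2a d a ℚ.* ι (y * z)
    y≤     : ι y ℚ.≤ d/2a d b ℚ.* ι (x * z)
    z≤     : ι z ℚ.≤ d/2a d c ℚ.* ι (x * y)

FundamentalSolutions : (a b c d e : ℕ)
  .{{_ : NonZero a}} .{{_ : NonZero b}} .{{_ : NonZero c}} →
  Pred (ℕ × ℕ × ℕ) 0ℓ
FundamentalSolutions a b c d e (x , y , z) = IsFundamental a b c d e x y z

{-# OPTIONS --safe #-}
-- Put u = ax², v = by², w = cz² and D = dxyz. Fundamentality says
-- 2u, 2v, 2w ≤ D, and e = u + v + w − D. Since a, b, c divide d and are
-- jointly coprime, abc divides d², hence uvw ≤ D². Order u ≤ v ≤ w and suppose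
-- e ≥ 5. Then 2w ≤ D forces w ≤ u + v − 5, and in this range
-- (u + v + w − 5)² < uvw, contradicting uvw ≤ D² ≤ (u + v + w − 5)².
module Submission where

open import Data.Nat using (ℕ; suc; pred; NonZero; _≤_; _<_; _+_; _*_; _^_; >-nonZero⁻¹)
open import Data.Nat.Properties
open import Data.Nat.Divisibility using (_∣_; ∣⇒≤; *-pres-∣; ∣-refl)
open import Data.Nat.GCD using (gcd; gcd-greatest; c*gcd[m,n]≡gcd[cm,cn])
open import Data.Nat.Tactic.RingSolver using (solve-∀)
open import Data.Integer as ℤ using (+_)
import Data.Integer.Properties as ℤ
import Data.Rational as ℚ
import Data.Rational.Properties as ℚ
open import Data.Rational.Unnormalised as ℚᵘ using (mkℚᵘ)
import Data.Rational.Unnormalised.Properties as ℚᵘ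
open import Data.Product using (_×_; _,_)
open import Data.Sum using (inj₁; inj₂)
open import Relation.Binary.PropositionalEquality
  using (_≡_; refl; sym; trans; cong; subst; subst₂; module ≡-Reasoning)
open import Relation.Nullary using (¬_)
open import Relation.Nullary.Decidable using (decidable-stable)
open import Relation.Unary using (Empty)
open import Defs

-- d² gcd(a, b, c) = gcd(d²a, d²b, d²c), and abc divides each of the three
-- arguments on the right.
abc∣d² : ∀ {a b c d} → a ∣ d → b ∣ d → c ∣ d → gcd a (gcd b c) ≡ 1 →
         a * b * c ∣ d * d
abc∣d² {a} {b} {c} {d} a∣d b∣d c∣d coprime =
  subst (a * b * c ∣_) d²gcd≡d²
    (gcd-greatest abc∣d²a (gcd-greatest abc∣d²b abc∣d²c))
  where
  open ≡-Reasoning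

  n = d * d

  bca : ∀ a b c → b * c * a ≡ a * b * c
  bca = solve-∀

  acb : ∀ a b c → a * c * b ≡ a * b * c
  acb = solve-∀

  abc∣d²a : a * b * c ∣ n * a
  abc∣d²a = subst (_∣ n * a) (bca a b c) (*-pres-∣ (*-pres-∣ b∣d c∣d) ∣-refl)

  abc∣d²b : a * b * c ∣ n * b
  abc∣d²b = subst (_∣ n * b) (acb a b c) (*-pres-∣ (*-pres-∣ a∣d c∣d) ∣-refl)

  abc∣d²c : a * b * c ∣ n * c
  abc∣d²c = *-pres-∣ (*-pres-∣ a∣d b∣d) ∣-refl

  d²gcd≡d² : gcd (n * a) (gcd (n * b) (n * c)) ≡ n
  d²gcd≡d² = begin
    gcd (n * a) (gcd (n * b) (n * c)) ≡⟨ cong (gcd (n * a)) (c*gcd[m,n]≡gcd[cm,cn] n b c) ⟨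
    gcd (n * a) (n * gcd b c)         ≡⟨ c*gcd[m,n]≡gcd[cm,cn] n a (gcd b c) ⟨
    n * gcd a (gcd b c)               ≡⟨ cong (n *_) coprime ⟩
    n * 1                             ≡⟨ *-identityʳ n ⟩
    n                                 ∎

-- The parameters are u = 5 + m + k, v = u + r, w = v + m, and the left-hand
-- side is (u + v + w − 5)²; the difference has only positive coefficients.
square<product : ∀ m k r → let u = 5 + m + k; s = 10 + 4 * m + 3 * k + 2 * r in
                 s * s < u * (u + r) * (u + r + m)
square<product m k r =
  ≤-trans (m≤m+n _ _) (≤-reflexive (expand m k r))
  where
  expand : ∀ m k r → let u = 5 + m + k; t = m + k; s = 10 + 4 * m + 3 * k + 2 * r in
           suc (s * s)
             + (24 + 15 * t + 6 * t * t + t * t * t + 5 * r + 6 * t * r + t * t * r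
                + r * (5 + 2 * t + t * t + r + t * r)
                + 5 * m + t * t * m + r * m + t * r * m + 3 * m * m + 4 * k * m)
           ≡ u * (u + r) * (u + r + m)
  expand = solve-∀

-- The estimate works from these facts alone, with the coefficients and unknowns forgotten. They are
-- symmetric in `u`, `v`, `w`, and the two adjacent swaps below generate every reordering.
record Balanced (D e u v w : ℕ) : Set where
  field
    2u≤D   : 2 * u ≤ D
    2v≤D   : 2 * v ≤ D
    2w≤D   : 2 * w ≤ D
    uvw≤D² : u * v * w ≤ D * D
    sum    : u + v + w ≡ D + e

module _ {D e : ℕ} where

  swap₁₂ : ∀ {u v w} → Balanced D e u v w → Balanced D e v u w
  swap₁₂ {u} {v} {w} β = record
    { 2u≤D   = 2v≤D
    ; 2v≤D   = 2u≤D
    ; 2w≤D   = 2w≤D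
    ; uvw≤D² = subst (_≤ D * D) (cong (_* w) (*-comm u v)) uvw≤D²
    ; sum    = trans (cong (_+ w) (+-comm v u)) sum
    } where open Balanced β

  swap₂₃ : ∀ {u v w} → Balanced D e u v w → Balanced D e u w v
  swap₂₃ {u} {v} {w} β = record
    { 2u≤D   = 2u≤D
    ; 2v≤D   = 2w≤D
    ; 2w≤D   = 2v≤D
    ; uvw≤D² = subst (_≤ D * D) (lemma* u v w) uvw≤D²
    ; sum    = trans (lemma+ u v w) sum
    } where
    open Balanced β
    lemma* : ∀ u v w → u * v * w ≡ u * w * v
    lemma* = solve-∀
    lemma+ : ∀ u v w → u + w + v ≡ u + v + w
    lemma+ = solve-∀

sorted-e≤4 : ∀ {D e u v w} → u ≤ v → v ≤ w → Balanced D e u v w → e ≤ 4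
sorted-e≤4 {D} {e} {u} u≤v v≤w β = ≮⇒≥ contra
  where
  open ≤-Reasoning
  open Balanced β

  regroup₁ : ∀ u r m → u + r + (u + r + m) + (5 + m) ≡ 2 * (u + r + m) + 5
  regroup₁ = solve-∀

  regroup₂ : ∀ u r m → u + (u + r) + (u + r + m) ≡ u + r + (u + r + m) + u
  regroup₂ = solve-∀

  regroup₃ : ∀ m k r → 5 + m + k + (5 + m + k + r) + (5 + m + k + r + m)
                     ≡ 10 + 4 * m + 3 * k + 2 * r + 5
  regroup₃ = solve-∀

  contra : ¬ 4 < e
  contra 5≤e
    with r , refl ← m≤n⇒∃[o]m+o≡n u≤v
    with m , refl ← m≤n⇒∃[o]m+o≡n v≤w
    -- As w = v + m, we have v + w + (5 + m) = 2w + 5 ≤ D + e = u + v + w. Cancelling v + w leaves 5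
    -- + m ≤ u, and `k` is the slack.
    with k , refl ← m≤n⇒∃[o]m+o≡n {5 + m} {u}
      (+-cancelˡ-≤ (u + r + (u + r + m)) (5 + m) u (begin
        u + r + (u + r + m) + (5 + m) ≡⟨ regroup₁ u r m ⟩
        2 * (u + r + m) + 5           ≤⟨ +-mono-≤ 2w≤D 5≤e ⟩
        D + e                         ≡⟨ sum ⟨
        u + (u + r) + (u + r + m)     ≡⟨ regroup₂ u r m ⟩
        u + r + (u + r + m) + u       ∎))
    = <⇒≱ (square<product m k r) (≤-trans uvw≤D² (*-mono-≤ D≤s D≤s))
    where
    -- The bound is u + v + w - 5 written in m, k, r; adding 5 to both sides avoids truncated
    -- subtraction.
    D≤s : D ≤ 10 + 4 * m + 3 * k + 2 * r
    D≤s = +-cancelʳ-≤ 5 D _ (begin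
      D + 5                                             ≤⟨ +-monoʳ-≤ D 5≤e ⟩
      D + e                                             ≡⟨ sum ⟨
      5 + m + k + (5 + m + k + r) + (5 + m + k + r + m) ≡⟨ regroup₃ m k r ⟩
      10 + 4 * m + 3 * k + 2 * r + 5                    ∎)

balanced-e≤4 : ∀ {D e} u v w → Balanced D e u v w → e ≤ 4
balanced-e≤4 u v w β with ≤-total u v | ≤-total v w | ≤-total u w
... | inj₁ u≤v | inj₁ v≤w | _        = sorted-e≤4 u≤v v≤w β
-- In the mixed cases v is the largest or the smallest of the three, so comparing u with w settles
-- the order.
... | inj₁ u≤v | inj₂ w≤v | inj₁ u≤w = sorted-e≤4 u≤w w≤v (swap₂₃ β)
... | inj₁ u≤v | inj₂ w≤v | inj₂ w≤u = sorted-e≤4 w≤u u≤v (swap₁₂ (swap₂₃ β))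
... | inj₂ v≤u | inj₁ v≤w | inj₁ u≤w = sorted-e≤4 v≤u u≤w (swap₁₂ β)
... | inj₂ v≤u | inj₁ v≤w | inj₂ w≤u = sorted-e≤4 v≤w w≤u (swap₂₃ (swap₁₂ β))
... | inj₂ v≤u | inj₂ w≤v | _        = sorted-e≤4 w≤v v≤u (swap₁₂ (swap₂₃ (swap₁₂ β)))

-- Elements of `ℚ` are reduced to lowest terms, which hides the denominator 2a. Among unnormalised
-- rationals it stays visible, and cross-multiplication gives the integer inequality.
clear-denominator : ∀ d a n {x} .{{_ : NonZero a}} →
                    ι x ℚ.≤ d/2a d a ℚ.* ι n → 2 * a * x ≤ d * n
clear-denominator d a@(suc _) n {x} x≤ =
  ℤ.drop‿+≤+ (subst₂ ℤ._≤_ lhs rhs (ℚᵘ.drop-*≤* unnormalised))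
  where
  -- `mkℚᵘ` stores the denominator minus one; matching `a` as a successor lets `pred` compute.
  q = mkℚᵘ (+ d) (pred (2 * a))

  unnormalised : mkℚᵘ (+ x) 0 ℚᵘ.≤ q ℚᵘ.* mkℚᵘ (+ n) 0
  unnormalised = begin
    mkℚᵘ (+ x) 0                             ≃⟨ ℚ.toℚᵘ-fromℚᵘ (mkℚᵘ (+ x) 0) ⟨
    ℚ.toℚᵘ (ι x)                             ≤⟨ ℚ.toℚᵘ-mono-≤ x≤ ⟩
    ℚ.toℚᵘ (d/2a d a ℚ.* ι n)                ≃⟨ ℚ.toℚᵘ-homo-* (d/2a d a) (ι n) ⟩
    ℚ.toℚᵘ (d/2a d a) ℚᵘ.* ℚ.toℚᵘ (ι n)      ≃⟨ ℚᵘ.*-cong (ℚ.toℚᵘ-fromℚᵘ q) (ℚ.toℚᵘ-fromℚᵘ (mkℚᵘ (+ n) 0)) ⟩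
    q ℚᵘ.* mkℚᵘ (+ n) 0                      ∎
    where open ℚᵘ.≤-Reasoning

  lhs : + x ℤ.* + (2 * a * 1) ≡ + (2 * a * x)
  lhs = trans (sym (ℤ.pos-* x (2 * a * 1)))
              (cong +_ (trans (*-comm x (2 * a * 1)) (cong (_* x) (*-identityʳ (2 * a)))))

  rhs : + d ℤ.* + n ℤ.* + 1 ≡ + (d * n)
  rhs = trans (ℤ.*-identityʳ (+ d ℤ.* + n)) (sym (ℤ.pos-* d n))

-- Multiplying x ≤ (d/2a)yz by 2ax gives 2ax² ≤ dxyz, and likewise for y and z. The product of the
-- three terms is abc(xyz)², while D² = d²(xyz)².
fundamental⇒balanced : ∀ {a b c d e x y z}
  .{{_ : NonZero a}} .{{_ : NonZero b}} .{{_ : NonZero c}} →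
  a * b * c ≤ d * d → IsFundamental a b c d e x y z →
  Balanced (d * x * y * z) e (a * x ^ 2) (b * y ^ 2) (c * z ^ 2)
fundamental⇒balanced {a} {b} {c} {d} {e} {x} {y} {z} abc≤d² f = record
  { 2u≤D   = begin
      2 * (a * x ^ 2)  ≡⟨ square a x ⟩
      2 * a * x * x    ≤⟨ *-monoˡ-≤ x (clear-denominator d a (y * z) x≤) ⟩
      d * (y * z) * x  ≡⟨ rotate₁ d x y z ⟩
      d * x * y * z    ∎
  ; 2v≤D   = begin
      2 * (b * y ^ 2)  ≡⟨ square b y ⟩
      2 * b * y * y    ≤⟨ *-monoˡ-≤ y (clear-denominator d b (x * z) y≤) ⟩
      d * (x * z) * y  ≡⟨ rotate₂ d x y z ⟩
      d * x * y * z    ∎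
  ; 2w≤D   = begin
      2 * (c * z ^ 2)  ≡⟨ square c z ⟩
      2 * c * z * z    ≤⟨ *-monoˡ-≤ z (clear-denominator d c (x * y) z≤) ⟩
      d * (x * y) * z  ≡⟨ cong (_* z) (*-assoc d x y) ⟨
      d * x * y * z    ∎
  ; uvw≤D² = begin
      a * x ^ 2 * (b * y ^ 2) * (c * z ^ 2)  ≡⟨ group a b c x y z ⟩
      a * b * c * (x * y * z * (x * y * z))  ≤⟨ *-monoˡ-≤ (x * y * z * (x * y * z)) abc≤d² ⟩
      d * d * (x * y * z * (x * y * z))      ≡⟨ ungroup d x y z ⟩
      d * x * y * z * (d * x * y * z)        ∎
  ; sum    = solves
  } where
  open IsFundamental f
  open ≤-Reasoning

  -- The ring solver does not handle _^_, so x ^ 2 is written in its unfolded form x * (x * 1).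
  square : ∀ a x → 2 * (a * (x * (x * 1))) ≡ 2 * a * x * x
  square = solve-∀

  rotate₁ : ∀ d x y z → d * (y * z) * x ≡ d * x * y * z
  rotate₁ = solve-∀

  rotate₂ : ∀ d x y z → d * (x * z) * y ≡ d * x * y * z
  rotate₂ = solve-∀

  group : ∀ a b c x y z → a * (x * (x * 1)) * (b * (y * (y * 1))) * (c * (z * (z * 1)))
                        ≡ a * b * c * (x * y * z * (x * y * z))
  group = solve-∀

  ungroup : ∀ d x y z → d * d * (x * y * z * (x * y * z)) ≡ d * x * y * z * (d * x * y * z)
  ungroup = solve-∀

theorem4p1 : ∀ (a b c d e : ℕ)
    .{{_ : NonZero a}} .{{_ : NonZero b}} .{{_ : NonZero c}}
    .{{_ : NonZero d}} .{{_ : NonZero e}} →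
    a ∣ d → b ∣ d → c ∣ d →
    gcd a (gcd b c) ≡ 1 →
    ¬ Empty (FundamentalSolutions a b c d e) →
    (1 ≤ e) × (e ≤ 4)
theorem4p1 a b c d e a∣d b∣d c∣d coprime F≢∅ =
  >-nonZero⁻¹ e ,
  -- `¬ Empty` yields no explicit solution, but `e ≤ 4` is decidable, so refuting its negation is
  -- enough.
  decidable-stable (e ≤? 4) λ e≰4 →
    F≢∅ λ _ f → e≰4 (balanced-e≤4 _ _ _ (fundamental⇒balanced abc≤d² f))
  where
  abc≤d² : a * b * c ≤ d * d
  -- Divisibility bounds the divisor because d² is nonzero.
  abc≤d² = ∣⇒≤ {{m*n≢0 d d}} (abc∣d² a∣d b∣d c∣d coprime)
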